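{- Let $\varphi:\{0,1\}^*\to\{0,1\}^*$ be a primitive uniform morphism and let $\mathbf{u}$ be an aperiodic fixed point of $\varphi$ such that $\mathbf{u}$ contains infinitely many antipalindromes as factors. Then $\varphi$ or $\varphi^2$ is conjugate to a morphism in class $\mathcal{A}_1$.
   Context: Words are finite sequences over the alphabet $\{0,1\}$; $\{0,1\}^*$ is the free monoid under concatenation with empty word $\varepsilon$. $\mathrm{E}$ is the antimorphism ($\mathrm{E}(uv)=\mathrm{E}(v)\mathrm{E}(u)$) with $\mathrm{E}(0)=1$, $\mathrm{E}(1)=0$, i.e. $\mathrm{E}(w_1\cdots w_n)=(1-w_n)\cdots(1-w_1)$; a word $w$ is an antipalindrome if $\mathrm{E}(w)=w$. A morphism $\varphi$ is primitive if there is $k$ such that every letter occurs in $\varphi^k(b)$ for every letter $b$; it is uniform if $|\varphi(0)|=|\varphi(1)|$. An infinite word $\mathbf{u}$ is a fixed point of $\varphi$ if $\varphi(\mathbf{u})=\mathbf{u}$ (with $\varphi$ extended letterwise to infinite words); $\mathbf{u}$ is aperiodic if it is not of the form $vw^\infty$ with $w\neq\varepsilon$. A morphism $\varphi$ is left conjugate to $\psi$ (and $\psi$ right conjugate to $\varphi$) if there is a word $q$ with $q\varphi(w)=\psi(w)q$ for all words $w$; two morphisms are conjugate if one is left conjugate to the other. A morphism $\varphi$ belongs to class $\mathcal{A}_1$ if there are words $\mathfrak{p},\mathfrak{s}$ with $\mathfrak{p}\neq\varepsilon$, $\mathfrak{s}$ an antipalindrome, $\varphi(0)=\mathfrak{p}\mathfrak{s}$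 and $\varphi(1)=\mathrm{E}(\mathfrak{p})\mathfrak{s}$. -}

module Defs where

open import Data.Bool using (Bool; true; false; not)
open import Data.Nat using (ℕ; zero; suc; _+_; _≤_; _<_)
open import Data.List using (List; []; _∷_; _++_; length; reverse; map; concatMap)
open import Data.List.Membership.Propositional using (_∈_; _∉_)
open import Data.Product using (Σ; ∃; _×_; _,_)
open import Data.Sum using (_⊎_)
open import Relation.Binary.PropositionalEquality using (_≡_; _≢_)
open import Relation.Nullary using (¬_)

-- Letters of the alphabet {0,1}: false = 0, true = 1.
Letter : Set
Letter = Bool

Word : Set
Word = List Letter

InfWord : Set
InfWord = ℕ → Letter

-- A morphism of {0,1}^* is determined by the images of the letters.
Morphism : Set
Morphism = Letter → Word

apply : Morphism → Word → Word
apply φ w = concatMap φ w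

_∘ₘ_ : Morphism → Morphism → Morphism
(φ ∘ₘ ψ) b = apply φ (ψ b)

_^ₘ_ : Morphism → ℕ → Morphism
φ ^ₘ zero = λ b → b ∷ []
φ ^ₘ suc k = φ ∘ₘ (φ ^ₘ k)

E : Word → Word
E w = reverse (map not w)

IsAntipalindrome : Word → Set
IsAntipalindrome w = E w ≡ w

IsPrimitive : Morphism → Set
IsPrimitive φ = ∃ λ k → ∀ b c → c ∈ (φ ^ₘ k) b

IsUniform : Morphism → Set
IsUniform φ = length (φ false) ≡ length (φ true)

slice : InfWord → ℕ → ℕ → Word
slice u i zero = []
slice u i (suc n) = u i ∷ slice u (suc i) n

prefix : InfWord → ℕ → Word
prefix u n = slice u 0 n

IsFactor : Word → InfWord → Set
IsFactor w u = ∃ λ i → slice u i (length w) ≡ w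

-- φ(u) = u: the image of every prefix of u is a prefix of u
-- (φ(u) is by definition the limit of the images of the prefixes of u).
IsFixedPoint : Morphism → InfWord → Set
IsFixedPoint φ u = ∀ n → prefix u (length (apply φ (prefix u n))) ≡ apply φ (prefix u n)

IsEventuallyPeriodic : InfWord → Set
IsEventuallyPeriodic u = ∃ λ p → ∃ λ N → (0 < p) × (∀ n → N ≤ n → u (n + p) ≡ u n)

IsAperiodic : InfWord → Set
IsAperiodic u = ¬ IsEventuallyPeriodic u

InfinitelyManyAntipalFactors : InfWord → Set
InfinitelyManyAntipalFactors u =
  ∀ (L : List Word) → ∃ λ w → IsFactor w u × IsAntipalindrome w × w ∉ L

LeftConjugate : Morphism → Morphism → Set
LeftConjugate φ ψ = ∃ λ q → ∀ (w : Word) → q ++ apply φ w ≡ apply ψ w ++ q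

Conjugate : Morphism → Morphism → Set
Conjugate φ ψ = LeftConjugate φ ψ ⊎ LeftConjugate ψ φ

InA1 : Morphism → Set
InA1 φ = ∃ λ 𝔭 → ∃ λ 𝔰 → (𝔭 ≢ []) × IsAntipalindrome 𝔰
         × (φ false ≡ 𝔭 ++ 𝔰) × (φ true ≡ E 𝔭 ++ 𝔰)

{-# OPTIONS --safe #-}
module Submission where

-- Write φ(a) = P C_a S with P and S the longest common prefix and suffix of φ(0) and φ(1), and
-- ψ(a) = C_a t with t = S P, a conjugate of φ; from position |P| on, u is made of the blocks ψ(u_n).
-- A long (anti)palindromic window of u maps ψ-blocks onto reversed ψ-blocks.  If the two block
-- structures were out of phase, then, as C_0 and C_1 differ at both ends, u_k would be a function
-- of u_{k+1} throughout a window, forcing period 2 there; primitivity and aperiodicity exclude this.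
-- So C_a is the mirror image of C_{γ(a)} for γ the identity or the exchange of letters, t is its own
-- mirror image, and u has a long window with symmetry γ.  Starting from antipalindromes, γ = exchange
-- puts ψ in class A₁.  If γ = id, then the palindromes so obtained can be analysed in the same way:
-- t is both a palindrome and an antipalindrome, so t = ε, and φ(1) is the reversal of the
-- antipalindrome φ(0), whence φ²(1) = E(φ²(0)).

open import Defs
open import Data.Bool using (true; false; not; _xor_)
open import Data.Bool.Properties using (_≟_; xor-assoc; xor-identityʳ; not-¬; ¬-not; not-involutive)
open import Data.Empty using (⊥-elim)
open import Data.List using (List; []; _∷_; _++_; _∷ʳ_; length; reverse; map)
open import Data.List.Membership.Propositional using (_∈_)
open import Data.List.Membership.Propositional.Properties using (∈-map⁺; ∈-++⁺ˡ; ∈-++⁺ʳ)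
open import Data.List.Properties
  using (≡-dec; ∷-injective; ++-assoc; ++-identityʳ; ++-cancelˡ; ++-conicalˡ; ++-conicalʳ; length-++; length-reverse;
         map-id; map-++; concatMap-++; unfold-reverse; reverse-++; reverse-involutive;
         reverse-map)
open import Data.List.Relation.Unary.Any using (here; there)
open import Data.Nat using (ℕ; zero; suc; _+_; _*_; _∸_; _^_; _≤_; _<_; z≤n; s≤s; NonZero; >-nonZero)
open import Data.Nat.DivMod using (_/_; _%_; m≡m%n+[m/n]*n; m%n<n; m/n*n≤m)
open import Data.Nat.Properties hiding (_≟_)
open import Data.Nat.Tactic.RingSolver using (solve-∀)
open import Data.Product using (∃; _×_; _,_; proj₁; proj₂)
open import Data.Sum using (_⊎_; inj₁; inj₂)
open import Relation.Binary.PropositionalEquality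
open import Relation.Nullary using (Dec; yes; no; contradiction)
open import Relation.Nullary.Decidable using (decidable-stable; _×-dec_; _⊎-dec_)

-- Letters, mirror images and slices.

-- Only meaningful for positions below the length; the value past the end is junk.
at : Word → ℕ → Letter
at []      _       = false
at (a ∷ w) zero    = a
at (a ∷ w) (suc j) = at w j

at-++ˡ : ∀ v {w} j → j < length v → at (v ++ w) j ≡ at v j
at-++ˡ (a ∷ v) zero    _         = refl
at-++ˡ (a ∷ v) (suc j) (s≤s j<v) = at-++ˡ v j j<v

at-++ʳ : ∀ v {w} j → at (v ++ w) (length v + j) ≡ at w j
at-++ʳ []      j = refl
at-++ʳ (a ∷ v) j = at-++ʳ v j

xor-cancelˡ : ∀ a {b c} → a xor b ≡ c → b ≡ a xor c
xor-cancelˡ true  eq = trans (sym (not-involutive _)) (cong not eq)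
xor-cancelˡ false eq = eq

two-letters : ∀ {a b c : Letter} → a ≢ b → a ≢ c → b ≡ c
two-letters a≢b a≢c = trans (¬-not (≢-sym a≢b)) (sym (¬-not (≢-sym a≢c)))

-- The letter `β` selects the symmetry: `mirror false` is reversal up to `mirror-false`, and
-- `mirror true` is definitionally `E`. Palindromes and antipalindromes can thus be treated
-- together.
mirror : Letter → Word → Word
mirror β w = reverse (map (β xor_) w)

mirror-false : ∀ w → mirror false w ≡ reverse w
mirror-false w = cong reverse (map-id w)

mirror-∷ʳ : ∀ β w a → mirror β (w ∷ʳ a) ≡ (β xor a) ∷ mirror β w
mirror-∷ʳ β w a = begin
  reverse (map (β xor_) (w ∷ʳ a))        ≡⟨ reverse-map (β xor_) (w ∷ʳ a) ⟨
  map (β xor_) (reverse (w ∷ʳ a))        ≡⟨ cong (map (β xor_)) (reverse-++ w (a ∷ [])) ⟩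
  (β xor a) ∷ map (β xor_) (reverse w)   ≡⟨ cong ((β xor a) ∷_) (reverse-map (β xor_) w) ⟩
  (β xor a) ∷ mirror β w                 ∎
  where open ≡-Reasoning

length-slice : ∀ u i n → length (slice u i n) ≡ n
length-slice u i zero    = refl
length-slice u i (suc n) = cong suc (length-slice u (suc i) n)

slice-++ : ∀ u i m n → slice u i (m + n) ≡ slice u i m ++ slice u (i + m) n
slice-++ u i zero    n = cong (λ k → slice u k n) (sym (+-identityʳ i))
slice-++ u i (suc m) n = cong (u i ∷_) (trans (slice-++ u (suc i) m n)
  (cong (λ k → slice u (suc i) m ++ slice u k n) (sym (+-suc i m))))

slice-∷ʳ : ∀ u i n → slice u i (suc n) ≡ slice u i n ∷ʳ u (i + n)
slice-∷ʳ u i n = trans (cong (slice u i) (+-comm 1 n)) (slice-++ u i n 1)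

slice-split : ∀ u i v {w} → slice u i (length (v ++ w)) ≡ v ++ w →
  slice u i (length v) ≡ v × slice u (i + length v) (length w) ≡ w
slice-split u i []      {w} eq = refl , trans (cong (λ k → slice u k (length w)) (+-identityʳ i)) eq
slice-split u i (a ∷ v) {w} eq with ∷-injective eq
... | eq₀ , eq₁ with slice-split u (suc i) v eq₁
...   | eqˡ , eqʳ = cong₂ _∷_ eq₀ eqˡ , trans (cong (λ k → slice u k (length w)) (+-suc i (length v))) eqʳ

at-slice : ∀ u i {n} j → j < n → at (slice u i n) j ≡ u (i + j)
at-slice u i zero    (s≤s _)   = cong u (sym (+-identityʳ i))
at-slice u i (suc j) (s≤s j<n) = trans (at-slice u (suc i) j j<n) (cong u (sym (+-suc i j)))

∈-slice : ∀ u i n {a} → a ∈ slice u i n → ∃ λ j → j < n × u (i + j) ≡ a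
∈-slice u i (suc n) (here eq) = 0 , s≤s z≤n , trans (cong u (+-identityʳ i)) (sym eq)
∈-slice u i (suc n) (there p) with ∈-slice u (suc i) n p
... | j , j<n , eq = suc j , s≤s j<n , trans (cong u (+-suc i j)) eq

-- Windows with a reflection symmetry.

-- The reflection x ↦ s − x of the window [lo , s − lo] is an (anti)palindromic occurrence.
Reflects : InfWord → Letter → ℕ → ℕ → Set
Reflects u β s lo = ∀ x y → x + y ≡ s → lo ≤ x → lo ≤ y → u x ≡ β xor u y

-- The window has `s − 2 lo + 1` positions, so the inequality makes it longer than `r`.
ReflectsUnboundedly : InfWord → Letter → Set
ReflectsUnboundedly u β = ∀ r → ∃ λ lo → ∃ λ s → Reflects u β s lo × lo + lo + r ≤ s

-- The first position `i` of one slice must be opposite to the last position `j + n − 1` of the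
-- other, which is the condition on `suc s`. The induction peels off these two letters.
reflects-slice : ∀ u β {s lo} → Reflects u β s lo → ∀ n i j → i + j + n ≡ suc s → lo ≤ i → lo ≤ j →
  slice u i n ≡ mirror β (slice u j n)
reflects-slice u β refl-s zero i j _ _ _ = refl
reflects-slice u β refl-s (suc n) i j eq lo≤i lo≤j = begin
  u i ∷ slice u (suc i) n                     ≡⟨ cong₂ _∷_ head-eq tail-eq ⟩
  (β xor u (j + n)) ∷ mirror β (slice u j n)  ≡⟨ mirror-∷ʳ β (slice u j n) (u (j + n)) ⟨
  mirror β (slice u j n ∷ʳ u (j + n))         ≡⟨ cong (mirror β) (slice-∷ʳ u j n) ⟨
  mirror β (slice u j (suc n))                ∎
  where
  open ≡-Reasoning
  head-eq = refl-s i (j + n) (suc-injective (trans (arith i j n) eq)) lo≤i (m≤n⇒m≤n+o n lo≤j)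
    where
    arith : ∀ i j n → suc (i + (j + n)) ≡ i + j + suc n
    arith = solve-∀
  tail-eq = reflects-slice u β refl-s n (suc i) j (trans (sym (+-suc (i + j) n)) eq) (m≤n⇒m≤1+n lo≤i) lo≤j

slice-reflects : ∀ u β n i j → slice u i n ≡ mirror β (slice u j n) →
  ∀ x y → suc (x + y) ≡ n → u (i + x) ≡ β xor u (j + y)
slice-reflects u β (suc n) i j eq x y x+y with ∷-injective (trans eq (trans (cong (mirror β) (slice-∷ʳ u j n))
                                                (mirror-∷ʳ β (slice u j n) (u (j + n)))))
slice-reflects u β (suc n) i j eq zero    y refl | eq₀ , _ = trans (cong u (+-identityʳ i)) eq₀
slice-reflects u β (suc n) i j eq (suc x) y x+y  | _ , eq₁ = trans (cong u (+-suc i x))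
  (slice-reflects u β n (suc i) j eq₁ x y (suc-injective x+y))

wordsUpTo : ℕ → List Word
wordsUpTo zero    = [] ∷ []
wordsUpTo (suc n) = [] ∷ map (false ∷_) (wordsUpTo n) ++ map (true ∷_) (wordsUpTo n)

∈-wordsUpTo : ∀ n w → length w ≤ n → w ∈ wordsUpTo n
∈-wordsUpTo zero    []          _       = here refl
∈-wordsUpTo (suc n) []          _       = here refl
∈-wordsUpTo (suc n) (false ∷ w) (s≤s l) = there (∈-++⁺ˡ (∈-map⁺ (false ∷_) (∈-wordsUpTo n w l)))
∈-wordsUpTo (suc n) (true ∷ w)  (s≤s l) =
  there (∈-++⁺ʳ (map (false ∷_) (wordsUpTo n)) (∈-map⁺ (true ∷_) (∈-wordsUpTo n w l)))

-- Only finitely many words have length at most `r`; an antipalindromic factor outside `wordsUpTo r`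
-- is therefore longer.
antipalindromes-reflect : ∀ {u} → InfinitelyManyAntipalFactors u → ReflectsUnboundedly u true
antipalindromes-reflect {u} inf r with inf (wordsUpTo r)
... | w , (i , occ) , anti , w∉ = reflect (length w) refl (≰⇒> (λ l → w∉ (∈-wordsUpTo r w l)))
  where
  reflect : ∀ n → length w ≡ n → r < n → ∃ λ lo → ∃ λ s → Reflects u true s lo × lo + lo + r ≤ s
  -- The occurrence covers the positions from `i` to `i + n`, and opposite positions add up to the
  -- sum of these two ends.
  reflect (suc n) refl-n (s≤s r≤n) = i , i + i + n , reflects , +-monoʳ-≤ (i + i) r≤n
    where
    occ-n : slice u i (suc n) ≡ w
    occ-n = trans (cong (slice u i) (sym refl-n)) occ
    mirrored : slice u i (suc n) ≡ mirror true (slice u i (suc n))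
    mirrored = trans occ-n (trans (sym anti) (cong E (sym occ-n)))
    arith : ∀ i a b → (i + a) + (i + b) ≡ i + i + (a + b)
    arith = solve-∀
    reflects : Reflects u true (i + i + n) i
    reflects x y x+y i≤x i≤y = begin
      u x                  ≡⟨ cong u (m+[n∸m]≡n i≤x) ⟨
      u (i + (x ∸ i))      ≡⟨ slice-reflects u true (suc n) i i mirrored (x ∸ i) (y ∸ i) (cong suc sum) ⟩
      not (u (i + (y ∸ i)))≡⟨ cong (λ z → not (u z)) (m+[n∸m]≡n i≤y) ⟩
      not (u y)            ∎
      where
      open ≡-Reasoning
      sum : (x ∸ i) + (y ∸ i) ≡ n
      sum = +-cancelˡ-≡ (i + i) _ _ (begin
        i + i + ((x ∸ i) + (y ∸ i))     ≡⟨ arith i (x ∸ i) (y ∸ i) ⟨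
        (i + (x ∸ i)) + (i + (y ∸ i))   ≡⟨ cong₂ _+_ (m+[n∸m]≡n i≤x) (m+[n∸m]≡n i≤y) ⟩
        x + y                           ≡⟨ x+y ⟩
        i + i + n                       ∎)

-- Synchronisation of blocks under a reflection.

-- The bound `N` does not depend on `i`: violations of period 2 recur with bounded gaps, so every
-- sufficiently long window contains one.
NonTwoPeriodicEverywhere : InfWord → ℕ → Set
NonTwoPeriodicEverywhere u N = ∀ i → ∃ λ k → i ≤ k × 2 + k ≤ i + N × u k ≢ u (2 + k)

-- As `a ≢ c`, the letter `b` is one of them. If `b` is `c`, the first two equations share the value
-- `H b`. If `b` is `a`, then `d` is `b` or `c`, and the third equation shares its value with the
-- first or the second.
determined-by-next : ∀ (G H : Letter → Letter) {a b c d} → G a ≡ H b → G b ≡ H c → G c ≡ H d →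
  a ≢ c → G a ≡ G c
determined-by-next G H {false} {_}     {false} p q r a≢c = contradiction refl a≢c
determined-by-next G H {true}  {_}     {true}  p q r a≢c = contradiction refl a≢c
determined-by-next G H {false} {true}  {true}  p q r a≢c = trans p (sym q)
determined-by-next G H {true}  {false} {false} p q r a≢c = trans p (sym q)
determined-by-next G H {false} {false} {true} {false} p q r a≢c = trans p (sym r)
determined-by-next G H {false} {false} {true} {true}  p q r a≢c = trans q (sym r)
determined-by-next G H {true}  {true}  {false} {true}  p q r a≢c = trans p (sym r)
determined-by-next G H {true}  {true}  {false} {false} p q r a≢c = trans q (sym r)

-- The hypotheses first and last encode that C 0 and C 1 differ in their first and last letters.
module Synchronisation
  (u : InfWord) (o m : ℕ) (C : Letter → Word) (t : Word) (p q : Letter)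
  (o≤L : o ≤ suc m + length t)
  (length-C : ∀ a → length (C a) ≡ suc m)
  (first : ∀ a → at (C a) 0 ≡ p xor a)
  (last : ∀ a → at (C a) m ≡ q xor a)
  (block : ∀ n → slice u ((suc m + length t) * n + o) (suc m + length t) ≡ C (u n) ++ t)
  (N : ℕ) (nonper : NonTwoPeriodicEverywhere u N)
  where

  L = suc m + length t

  block-split : ∀ n → slice u (L * n + o) (suc m) ≡ C (u n) × slice u (L * n + o + suc m) (length t) ≡ t
  block-split n with slice-split u (L * n + o) (C (u n)) {t}
                       (trans (cong (slice u (L * n + o)) length-block) (block n))
    where
    length-block : length (C (u n) ++ t) ≡ L
    length-block = trans (length-++ (C (u n))) (cong (_+ length t) (length-C (u n)))
  ... | eqC , eqt rewrite length-C (u n) = eqC , eqt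

  u-at : ∀ n j → j < L → u (L * n + o + j) ≡ at (C (u n) ++ t) j
  u-at n j j<L = trans (sym (at-slice u (L * n + o) j j<L)) (cong (λ w → at w j) (block n))

  u-first : ∀ n → u (L * n + o) ≡ p xor u n
  u-first n = begin
    u (L * n + o)          ≡⟨ cong u (+-identityʳ (L * n + o)) ⟨
    u (L * n + o + 0)      ≡⟨ u-at n 0 (s≤s z≤n) ⟩
    at (C (u n) ++ t) 0    ≡⟨ at-++ˡ (C (u n)) 0 (subst (0 <_) (sym (length-C (u n))) (s≤s z≤n)) ⟩
    at (C (u n)) 0         ≡⟨ first (u n) ⟩
    p xor u n              ∎
    where open ≡-Reasoning

  u-last : ∀ n → u (L * n + o + m) ≡ q xor u n
  u-last n = begin
    u (L * n + o + m)      ≡⟨ u-at n m (s≤s (m≤m+n m (length t))) ⟩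
    at (C (u n) ++ t) m    ≡⟨ at-++ˡ (C (u n)) m (subst (m <_) (sym (length-C (u n))) ≤-refl) ⟩
    at (C (u n)) m         ≡⟨ last (u n) ⟩
    q xor u n              ∎
    where open ≡-Reasoning

  u-tail : ∀ n j → suc m + j < L → u (L * n + o + (suc m + j)) ≡ at t j
  u-tail n j j<L = trans (u-at n (suc m + j) j<L)
    (trans (cong (λ l → at (C (u n) ++ t) (l + j)) (sym (length-C (u n)))) (at-++ʳ (C (u n)) j))

  -- Blocks with index at least `lo′` start inside the reflecting window, and `K` is the sum of the
  -- indices of two blocks facing each other. By `wide`, a violation of period 2 fits in together
  -- with the blocks facing it.
  module Window (β : Letter) {s lo lo′ K : ℕ} (sym-s : Reflects u β s lo)
    (lo≤ : lo ≤ L * lo′) (wide : lo′ + lo′ + N ≤ K) where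

    low : ∀ {n} j → lo′ ≤ n → lo ≤ L * n + o + j
    low {n} j lo′≤n = ≤-trans lo≤ (≤-trans (*-monoʳ-≤ L lo′≤n)
      (≤-trans (m≤m+n (L * n) o) (m≤m+n (L * n + o) j)))

    arith-sum : ∀ L n k o i j → (L * n + o + i) + (L * k + o + j) ≡ L * (n + k) + (o + o + (i + j))
    arith-sum = solve-∀

    opposite : ∀ {n k} i j → lo′ ≤ n → lo′ ≤ k → s ≡ L * (n + k) + (o + o + (i + j)) →
      u (L * n + o + i) ≡ β xor u (L * k + o + j)
    opposite {n} {k} i j n≥ k≥ eq =
      sym-s _ _ (trans (arith-sum L n k o i j) (sym eq)) (low i n≥) (low j k≥)

    pivot = nonper lo′
    k₀ = proj₁ pivot
    k₀≥ : lo′ ≤ k₀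
    k₀≥ = proj₁ (proj₂ pivot)
    u-k₀ : u k₀ ≢ u (2 + k₀)
    u-k₀ = proj₂ (proj₂ (proj₂ pivot))

    -- The blocks `n₀`, `1 + n₀`, `2 + n₀` face `2 + k₀`, `1 + k₀`, `k₀` respectively.
    n₀ = K ∸ (2 + k₀)
    room : 2 + k₀ + lo′ ≤ K
    room = ≤-trans (+-monoˡ-≤ lo′ (proj₁ (proj₂ (proj₂ pivot)))) (subst (_≤ K) (arith lo′ N) wide)
      where
      arith : ∀ l N → l + l + N ≡ l + N + l
      arith = solve-∀
    n₀≥ : lo′ ≤ n₀
    n₀≥ = subst (_≤ n₀) (m+n∸m≡n (2 + k₀) lo′) (∸-monoˡ-≤ (2 + k₀) room)
    n₀+ : n₀ + (2 + k₀) ≡ K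
    n₀+ = m∸n+n≡m (≤-trans (m≤m+n (2 + k₀) lo′) room)
    n₀+₁ : suc n₀ + (1 + k₀) ≡ K
    n₀+₁ = trans (sym (+-suc n₀ (1 + k₀))) n₀+
    n₀+₂ : 2 + n₀ + k₀ ≡ K
    n₀+₂ = trans (sym (+-suc (suc n₀) k₀)) n₀+₁

    -- The letters at `k₀` and `2 + k₀` are distinct, hence exhaust the alphabet. Equal values there
    -- would make `G` constant, and `det` would then identify these two letters.
    letter-determined : (G : Letter → Letter) →
      (∀ n k → lo′ ≤ n → lo′ ≤ k → n + k ≡ K → u n ≡ G (u k)) → G (u k₀) ≢ G (u (2 + k₀))
    letter-determined G det Geq = u-k₀ (begin
      u k₀               ≡⟨ det k₀ (2 + n₀) k₀≥ n₀≥₂ (trans (+-comm k₀ (2 + n₀)) n₀+₂) ⟩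
      G (u (2 + n₀))     ≡⟨ G-const (u (2 + n₀)) (u n₀) ⟩
      G (u n₀)           ≡⟨ det (2 + k₀) n₀ k₀≥₂ n₀≥ (trans (+-comm (2 + k₀) n₀) n₀+) ⟨
      u (2 + k₀)         ∎)
      where
      open ≡-Reasoning
      n₀≥₂ : lo′ ≤ 2 + n₀
      n₀≥₂ = m≤n⇒m≤o+n 2 n₀≥
      k₀≥₂ : lo′ ≤ 2 + k₀
      k₀≥₂ = m≤n⇒m≤o+n 2 k₀≥
      const : ∀ a b → a ≢ b → G a ≡ G b → ∀ x y → G x ≡ G y
      const false false a≢b _ = contradiction refl a≢b
      const true  true  a≢b _ = contradiction refl a≢b
      const false true  _ e false false = refl
      const false true  _ e false true  = e
      const false true  _ e true  false = sym e
      const false true  _ e true  true  = refl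
      const true  false _ e false false = refl
      const true  false _ e false true  = sym e
      const true  false _ e true  false = e
      const true  false _ e true  true  = refl
      G-const : ∀ x y → G x ≡ G y
      G-const = const (u k₀) (u (2 + k₀)) u-k₀ Geq

    -- Here `e` is the phase between the blocks and their mirror images. For `n + k ≡ K`, the first
    -- letter of `C (u n)` faces position `m + e` counted from the start of block `k`. If `e` is
    -- positive, this position lies either in `t` or in block `suc k`; both are refuted by
    -- `letter-determined`.
    aligned : ∀ e → e < L → s ≡ L * K + (o + o + (m + e)) → e ≡ 0
    aligned zero    _   _  = refl
    aligned (suc e) e<L eq with ≤-<-connex L (m + suc e)
    ... | inj₁ wrap = ⊥-elim (letter-determined G determined
            (determined-by-next G H
              (GH (2 + n₀) k₀ (m≤n⇒m≤o+n 2 n₀≥) k₀≥ n₀+₂)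
              (GH (1 + n₀) (1 + k₀) (m≤n⇒m≤o+n 1 n₀≥) (m≤n⇒m≤o+n 1 k₀≥) n₀+₁)
              (GH n₀ (2 + k₀) n₀≥ (m≤n⇒m≤o+n 2 k₀≥) n₀+) u-k₀))
      where
      e′ = m + suc e ∸ L
      e′+ : L + e′ ≡ m + suc e
      e′+ = m+[n∸m]≡n wrap
      e′<L : e′ < L
      e′<L = +-cancelˡ-< L _ _ (subst (_< L + L) (sym e′+)
        (+-mono-≤-< (m≤n⇒m≤1+n (m≤m+n m (length t))) e<L))
      G H : Letter → Letter
      -- `G` recovers `u n` from its last letter, facing position `suc e` of block `k`; `H` recovers
      -- it from its first letter, facing position `e′` of block `suc k`. Comparing them at three
      -- consecutive blocks gives the input of `determined-by-next`.
      G x = q xor (β xor at (C x ++ t) (suc e))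
      H x = p xor (β xor at (C x ++ t) e′)
      determined : ∀ n k → lo′ ≤ n → lo′ ≤ k → n + k ≡ K → u n ≡ G (u k)
      determined n k n≥ k≥ refl = xor-cancelˡ q (begin
        q xor u n                                ≡⟨ u-last n ⟨
        u (L * n + o + m)                        ≡⟨ opposite m (suc e) n≥ k≥ eq ⟩
        β xor u (L * k + o + suc e)              ≡⟨ cong (β xor_) (u-at k (suc e) e<L) ⟩
        β xor at (C (u k) ++ t) (suc e)          ∎)
        where open ≡-Reasoning
      arith : ∀ L k o e′ → L * k + o + (L + e′) ≡ L * suc k + o + e′
      arith = solve-∀
      GH : ∀ n k → lo′ ≤ n → lo′ ≤ k → n + k ≡ K → G (u k) ≡ H (u (suc k))
      GH n k n≥ k≥ sum = trans (sym (determined n k n≥ k≥ sum)) (xor-cancelˡ p (begin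
        p xor u n                                ≡⟨ u-first n ⟨
        u (L * n + o)                            ≡⟨ cong u (+-identityʳ (L * n + o)) ⟨
        u (L * n + o + 0)                        ≡⟨ opposite 0 (m + suc e) n≥ k≥ eq′ ⟩
        β xor u (L * k + o + (m + suc e))        ≡⟨ cong (λ z → β xor u (L * k + o + z)) e′+ ⟨
        β xor u (L * k + o + (L + e′))           ≡⟨ cong (λ z → β xor u z) (arith L k o e′) ⟩
        β xor u (L * suc k + o + e′)             ≡⟨ cong (β xor_) (u-at (suc k) e′ e′<L) ⟩
        β xor at (C (u (suc k)) ++ t) e′         ∎))
        where
        open ≡-Reasoning
        eq′ : s ≡ L * (n + k) + (o + o + (0 + (m + suc e)))
        eq′ = trans eq (cong (λ z → L * z + (o + o + (m + suc e))) (sym sum))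
    -- The facing position `m + suc e` is past the core and still within the block, so its letter
    -- belongs to `t` and `u n` does not depend on `k`.
    ... | inj₂ <L = ⊥-elim (letter-determined (λ _ → p xor (β xor at t e)) determined refl)
      where
      determined : ∀ n k → lo′ ≤ n → lo′ ≤ k → n + k ≡ K → u n ≡ p xor (β xor at t e)
      determined n k n≥ k≥ refl = xor-cancelˡ p (begin
        p xor u n                                ≡⟨ u-first n ⟨
        u (L * n + o)                            ≡⟨ cong u (+-identityʳ (L * n + o)) ⟨
        u (L * n + o + 0)                        ≡⟨ opposite 0 (m + suc e) n≥ k≥ eq ⟩
        β xor u (L * k + o + (m + suc e))        ≡⟨ cong (λ z → β xor u (L * k + o + z)) (+-suc m e) ⟩
        β xor u (L * k + o + (suc m + e))        ≡⟨ cong (β xor_) (u-tail k e (subst (_< L) (+-suc m e) <L)) ⟩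
        β xor at t e                             ∎)
        where open ≡-Reasoning

    module Aligned (s≡ : s ≡ L * K + (o + o + m)) where

      -- In phase, the first letter `p xor u n` faces the last letter `q xor u k`; solving for `u n`
      -- gives this exchange.
      γ = p xor (β xor q)

      letters : Reflects u γ K lo′
      letters n k refl n≥ k≥ = begin
        u n                                ≡⟨ xor-cancelˡ p (trans (sym (u-first n)) flipped) ⟩
        p xor (β xor (q xor u k))          ≡⟨ cong (p xor_) (xor-assoc β q (u k)) ⟨
        p xor ((β xor q) xor u k)          ≡⟨ xor-assoc p (β xor q) (u k) ⟨
        γ xor u k                          ∎
        where
        open ≡-Reasoning
        flipped : u (L * n + o) ≡ β xor (q xor u k)
        flipped = trans (cong u (sym (+-identityʳ (L * n + o))))
          (trans (opposite 0 m n≥ k≥ s≡) (cong (β xor_) (u-last k)))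

      C-mirror-at : ∀ n k → lo′ ≤ n → lo′ ≤ k → n + k ≡ K → C (u n) ≡ mirror β (C (γ xor u n))
      C-mirror-at n k n≥ k≥ sum = begin
        C (u n)                                    ≡⟨ proj₁ (block-split n) ⟨
        slice u (L * n + o) (suc m)                ≡⟨ reflects-slice u β sym-s (suc m) (L * n + o) (L * k + o)
                                                        position (low′ n≥) (low′ k≥) ⟩
        mirror β (slice u (L * k + o) (suc m))     ≡⟨ cong (mirror β) (proj₁ (block-split k)) ⟩
        mirror β (C (u k))                         ≡⟨ cong (λ a → mirror β (C a))
                                                        (letters k n (trans (+-comm k n) sum) k≥ n≥) ⟩
        mirror β (C (γ xor u n))                   ∎
        where
        open ≡-Reasoning
        low′ : ∀ {n} → lo′ ≤ n → lo ≤ L * n + o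
        low′ {n} n≥ = subst (lo ≤_) (+-identityʳ (L * n + o)) (low 0 n≥)
        arith : ∀ L n k o m → L * n + o + (L * k + o) + suc m ≡ suc (L * (n + k) + (o + o + m))
        arith = solve-∀
        position : L * n + o + (L * k + o) + suc m ≡ suc s
        position = trans (arith L n k o m)
          (cong suc (trans (cong (λ z → L * z + (o + o + m)) sum) (sym s≡)))

      C-mirror : ∀ a → C a ≡ mirror β (C (γ xor a))
      -- The blocks `k₀` and `2 + k₀` carry the two different letters, so one of them provides
      -- `C a`.
      C-mirror a with u k₀ ≟ a
      ... | yes refl = C-mirror-at k₀ (2 + n₀) k₀≥ (m≤n⇒m≤o+n 2 n₀≥) (trans (+-comm k₀ (2 + n₀)) n₀+₂)
      ... | no u≢a rewrite sym (two-letters u-k₀ u≢a) =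
        C-mirror-at (2 + k₀) n₀ (m≤n⇒m≤o+n 2 k₀≥) n₀≥ (trans (+-comm (2 + k₀) n₀) n₀+)

      -- The copy of `t` between blocks `n₀` and `1 + n₀` faces the copy between blocks `1 + k₀` and
      -- `2 + k₀`; the block indices preceding these copies add up to `K − 1`.
      t-mirror : t ≡ mirror β t
      t-mirror = begin
        t                                                  ≡⟨ proj₂ (block-split n₀) ⟨
        slice u (L * n₀ + o + suc m) (length t)            ≡⟨ reflects-slice u β sym-s (length t) _ _ position
                                                                (low (suc m) n₀≥) (low (suc m) (m≤n⇒m≤o+n 1 k₀≥)) ⟩
        mirror β (slice u (L * (1 + k₀) + o + suc m) (length t)) ≡⟨ cong (mirror β) (proj₂ (block-split (1 + k₀))) ⟩
        mirror β t                                         ∎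
        where
        open ≡-Reasoning
        arith : ∀ m r n k o → let L = suc m + r in
          L * n + o + suc m + (L * k + o + suc m) + r ≡ suc (L * (suc n + k) + (o + o + m))
        arith = solve-∀
        position : L * n₀ + o + suc m + (L * (1 + k₀) + o + suc m) + length t ≡ suc s
        position = trans (arith m (length t) n₀ (1 + k₀) o)
          (cong suc (trans (cong (λ z → L * z + (o + o + m)) n₀+₁) (sym s≡)))

  -- Perfect alignment means that `s − base` is a multiple of `L`; quotient and remainder of this
  -- division are `K` and the phase `e`. Once `e` vanishes, the block indices themselves form a
  -- reflecting window with sum `K`.
  desubstitute : ∀ β r → ReflectsUnboundedly u β →
    (∃ λ lo → ∃ λ s → Reflects u (p xor (β xor q)) s lo × lo + lo + r ≤ s) ×
    (∀ a → C a ≡ mirror β (C ((p xor (β xor q)) xor a))) × t ≡ mirror β t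
  -- Of the six additional blocks, two pay for rounding `lo` up to `L * lo′` at both ends, and four
  -- for `base + e`, as `base` is at most `3 L` and `e` is below `L`.
  desubstitute β r refl-u with refl-u (L * (r + N + 6))
  ... | lo , s , sym-s , long = (lo′ , K , A.letters , ≤-trans (+-monoʳ-≤ (lo′ + lo′) (m≤m+n r N)) wide)
                              , A.C-mirror , A.t-mirror
    where
    base = o + o + m
    e = (s ∸ base) % L
    K = (s ∸ base) / L
    lo′ = suc (lo / L)

    e<L : e < L
    e<L = m%n<n (s ∸ base) L

    lo≡ : lo ≡ lo % L + (lo / L) * L
    lo≡ = m≡m%n+[m/n]*n lo L

    lo≤ : lo ≤ L * lo′
    lo≤ = begin
      lo                         ≡⟨ lo≡ ⟩
      lo % L + (lo / L) * L      ≤⟨ +-monoˡ-≤ _ (<⇒≤ (m%n<n lo L)) ⟩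
      L + (lo / L) * L           ≡⟨ *-comm L lo′ ⟨
      L * lo′                    ∎
      where open ≤-Reasoning

    lo′≤ : L * lo′ ≤ L + lo
    lo′≤ = begin
      L * lo′                    ≡⟨ *-comm L lo′ ⟩
      L + (lo / L) * L           ≤⟨ +-monoʳ-≤ L (m/n*n≤m lo L) ⟩
      L + lo                     ∎
      where open ≤-Reasoning

    base≤ : base ≤ L + L + L
    base≤ = +-mono-≤ (+-mono-≤ o≤L o≤L) (m≤n⇒m≤1+n (m≤m+n m (length t)))

    base≤s : base ≤ s
    base≤s = begin
      base                         ≤⟨ base≤ ⟩
      L + L + L                    ≤⟨ m≤m+n _ _ ⟩
      L + L + L + (lo + lo + L * (r + N + 3)) ≡⟨ arith L lo (r + N) ⟩
      lo + lo + L * (r + N + 6)    ≤⟨ long ⟩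
      s                            ∎
      where
      open ≤-Reasoning
      arith : ∀ L lo r → L + L + L + (lo + lo + L * (r + 3)) ≡ lo + lo + L * (r + 6)
      arith = solve-∀

    s≡ : s ≡ L * K + (o + o + (m + e))
    s≡ = begin
      s                            ≡⟨ m∸n+n≡m base≤s ⟨
      s ∸ base + base              ≡⟨ cong (_+ base) (m≡m%n+[m/n]*n (s ∸ base) L) ⟩
      e + K * L + (o + o + m)      ≡⟨ arith e K L o m ⟩
      L * K + (o + o + (m + e))    ∎
      where
      open ≡-Reasoning
      arith : ∀ e K L o m → e + K * L + (o + o + m) ≡ L * K + (o + o + (m + e))
      arith = solve-∀

    wide : lo′ + lo′ + (r + N) ≤ K
    wide = *-cancelˡ-≤ L (+-cancelʳ-≤ (L + L + L + L) _ _ (begin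
      L * (lo′ + lo′ + (r + N)) + (L + L + L + L)        ≡⟨ arith₁ L lo′ (r + N) ⟩
      L * lo′ + L * lo′ + (L * (r + N) + (L + L + L + L))≤⟨ +-monoˡ-≤ _ (+-mono-≤ lo′≤ lo′≤) ⟩
      L + lo + (L + lo) + (L * (r + N) + (L + L + L + L))≡⟨ arith₂ L lo (r + N) ⟩
      lo + lo + L * (r + N + 6)                          ≤⟨ long ⟩
      s                                                  ≡⟨ s≡ ⟩
      L * K + (o + o + (m + e))                          ≡⟨ cong (L * K +_) (+-assoc (o + o) m e) ⟨
      L * K + (base + e)                                 ≤⟨ +-monoʳ-≤ (L * K) (+-mono-≤ base≤ (<⇒≤ e<L)) ⟩
      L * K + (L + L + L + L)                            ∎))
      where
      open ≤-Reasoning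
      arith₁ : ∀ L l r → L * (l + l + r) + (L + L + L + L) ≡ L * l + L * l + (L * r + (L + L + L + L))
      arith₁ = solve-∀
      arith₂ : ∀ L lo r → L + lo + (L + lo) + (L * r + (L + L + L + L)) ≡ lo + lo + L * (r + 6)
      arith₂ = solve-∀

    module W = Window β sym-s lo≤ (≤-trans (+-monoʳ-≤ (lo′ + lo′) (m≤n+m N r)) wide)
    module A = W.Aligned (trans s≡ (cong (λ z → L * K + (o + o + z))
      (trans (cong (m +_) (W.aligned e e<L s≡)) (+-identityʳ m))))

-- Blocks and bounded gaps in a fixed point of a uniform morphism.

module FixedPoint (φ : Morphism) (u : InfWord) (uniform : IsUniform φ) (fixed : IsFixedPoint φ u) where

  L = length (φ false)

  length-φ : ∀ a → length (φ a) ≡ L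
  length-φ false = refl
  length-φ true  = sym uniform

  length-apply : ∀ w → length (apply φ w) ≡ L * length w
  length-apply []      = sym (*-zeroʳ L)
  length-apply (a ∷ w) = begin
    length (φ a ++ apply φ w)        ≡⟨ length-++ (φ a) ⟩
    length (φ a) + length (apply φ w)≡⟨ cong₂ _+_ (length-φ a) (length-apply w) ⟩
    L + L * length w                 ≡⟨ *-suc L (length w) ⟨
    L * suc (length w)               ∎
    where open ≡-Reasoning

  prefix-image : ∀ n → prefix u (L * n) ≡ apply φ (prefix u n)
  prefix-image n = trans (cong (prefix u) (sym (trans (length-apply (prefix u n))
    (cong (L *_) (length-slice u 0 n))))) (fixed n)

  -- The hypothesis `fixed` concerns prefixes; cancelling the image of the first `i` letters carries
  -- it over to inner factors.
  slice-image : ∀ i n → slice u (L * i) (L * n) ≡ apply φ (slice u i n)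
  slice-image i n = ++-cancelˡ (apply φ (prefix u i)) _ _ (begin
    apply φ (prefix u i) ++ slice u (L * i) (L * n)   ≡⟨ cong (_++ slice u (L * i) (L * n)) (prefix-image i) ⟨
    prefix u (L * i) ++ slice u (L * i) (L * n)       ≡⟨ slice-++ u 0 (L * i) (L * n) ⟨
    prefix u (L * i + L * n)                          ≡⟨ cong (prefix u) (*-distribˡ-+ L i n) ⟨
    prefix u (L * (i + n))                            ≡⟨ prefix-image (i + n) ⟩
    apply φ (prefix u (i + n))                        ≡⟨ cong (apply φ) (slice-++ u 0 i n) ⟩
    apply φ (prefix u i ++ slice u i n)               ≡⟨ concatMap-++ φ (prefix u i) (slice u i n) ⟩
    apply φ (prefix u i) ++ apply φ (slice u i n)     ∎)
    where open ≡-Reasoning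

  slice-block : ∀ n → slice u (L * n) L ≡ φ (u n)
  slice-block n = trans (cong (slice u (L * n)) (sym (*-identityʳ L)))
    (trans (slice-image n 1) (++-identityʳ (φ (u n))))

  slice-iterate : ∀ k n → slice u (L ^ k * n) (L ^ k) ≡ (φ ^ₘ k) (u n)
  slice-iterate zero    n = cong (λ i → u i ∷ []) (*-identityˡ n)
  slice-iterate (suc k) n = begin
    slice u (L * L ^ k * n) (L * L ^ k)      ≡⟨ cong (λ i → slice u i (L * L ^ k)) (*-assoc L (L ^ k) n) ⟩
    slice u (L * (L ^ k * n)) (L * L ^ k)    ≡⟨ slice-image (L ^ k * n) (L ^ k) ⟩
    apply φ (slice u (L ^ k * n) (L ^ k))    ≡⟨ cong (apply φ) (slice-iterate k n) ⟩
    (φ ^ₘ suc k) (u n)                       ∎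
    where open ≡-Reasoning

  module _ (primitive-φ : IsPrimitive φ) where

    k = proj₁ primitive-φ
    W = L ^ k

    letter-occurs : ∀ n a → ∃ λ j → j < W × u (W * n + j) ≡ a
    letter-occurs n a = ∈-slice u (W * n) W (subst (a ∈_) (sym (slice-iterate k n)) (proj₂ primitive-φ (u n) a))

    2≤W : 2 ≤ W
    2≤W with letter-occurs 0 false | letter-occurs 0 true
    ... | zero  , _  , e₀ | zero  , _  , e₁ = contradiction (trans (sym e₀) e₁) λ ()
    ... | suc _ , lt , _  | _               = ≤-trans (s≤s (s≤s z≤n)) lt
    ... | zero  , _  , _  | suc _ , lt , _  = ≤-trans (s≤s (s≤s z≤n)) lt

    instance
      W≢0 : NonZero W
      W≢0 = >-nonZero (≤-trans (s≤s z≤n) 2≤W)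

    2≤L : 2 ≤ L
    2≤L = ≰⇒> λ L≤1 → <⇒≱ 2≤W (≤-trans (^-monoˡ-≤ k L≤1) (≤-reflexive (^-zeroˡ k)))

    n<L^n : ∀ n → n < L ^ n
    n<L^n zero    = s≤s z≤n
    n<L^n (suc n) = begin
      1 + suc n         ≤⟨ +-mono-≤ (≤-trans (s≤s z≤n) (n<L^n n)) (n<L^n n) ⟩
      L ^ n + L ^ n     ≡⟨ cong (L ^ n +_) (+-identityʳ (L ^ n)) ⟨
      2 * L ^ n         ≤⟨ *-monoˡ-≤ (L ^ n) 2≤L ⟩
      L * L ^ n         ∎
      where open ≤-Reasoning

    -- By primitivity every aligned block of length `W` contains every letter. The block following
    -- the one around `i` ends within distance `2 W` of `i`.
    first-letter-recurs : ∀ i → ∃ λ n → i ≤ n × n ≤ i + (W + W) × u n ≡ u 0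
    first-letter-recurs i with letter-occurs (suc (i / W)) (u 0)
    ... | j , j<W , eq = n , i≤n , n≤ , eq
      where
      n = W * suc (i / W) + j
      i≤n : i ≤ n
      i≤n = begin
        i                          ≡⟨ m≡m%n+[m/n]*n i W ⟩
        i % W + (i / W) * W        ≤⟨ +-monoˡ-≤ _ (<⇒≤ (m%n<n i W)) ⟩
        W + (i / W) * W            ≡⟨ *-comm W (suc (i / W)) ⟨
        W * suc (i / W)            ≤⟨ m≤m+n _ j ⟩
        n                          ∎
        where open ≤-Reasoning
      n≤ : n ≤ i + (W + W)
      n≤ = begin
        W * suc (i / W) + j        ≤⟨ +-monoʳ-≤ (W * suc (i / W)) (<⇒≤ j<W) ⟩
        W * suc (i / W) + W        ≡⟨ cong (_+ W) (*-comm W (suc (i / W))) ⟩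
        W + (i / W) * W + W        ≤⟨ +-monoˡ-≤ W (+-monoʳ-≤ W (m/n*n≤m i W)) ⟩
        W + i + W                  ≡⟨ arith W i ⟩
        i + (W + W)                ∎
        where
        open ≤-Reasoning
        arith : ∀ W i → W + i + W ≡ i + (W + W)
        arith = solve-∀

    -- Wherever `u 0` recurs, its image under the `K`-th power of `φ` repeats the first `Z` letters
    -- of `u`. Since `Z` exceeds `2 + k₀`, the violation at `k₀` is copied along.
    spread-non-two-periodic : ∀ K k₀ → K ≡ 2 + k₀ → u k₀ ≢ u (2 + k₀) → ∃ (NonTwoPeriodicEverywhere u)
    -- The next recurrence of `u 0` is at most `1 + 2 W` blocks of length `Z` after the block of
    -- `i`; the last `Z` covers the offset `2 + k₀`.
    spread-non-two-periodic K k₀ K≡ u-k₀ = Z * suc (W + W) + Z , witness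
      where
      Z = L ^ K
      K<Z : K < Z
      K<Z = n<L^n K
      instance
        Z≢0 : NonZero Z
        Z≢0 = >-nonZero (≤-trans (s≤s z≤n) K<Z)
      copy : ∀ n → u n ≡ u 0 → ∀ j → j < Z → u (Z * n + j) ≡ u j
      copy n eq j j<Z = begin
        u (Z * n + j)                    ≡⟨ at-slice u (Z * n) j j<Z ⟨
        at (slice u (Z * n) Z) j         ≡⟨ cong (λ w → at w j) (slice-iterate K n) ⟩
        at ((φ ^ₘ K) (u n)) j            ≡⟨ cong (λ a → at ((φ ^ₘ K) a) j) eq ⟩
        at ((φ ^ₘ K) (u 0)) j            ≡⟨ cong (λ w → at w j) (slice-iterate K 0) ⟨
        at (slice u (Z * 0) Z) j         ≡⟨ at-slice u (Z * 0) j j<Z ⟩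
        u (Z * 0 + j)                    ≡⟨ cong (λ i → u (i + j)) (*-zeroʳ Z) ⟩
        u j                              ∎
        where open ≡-Reasoning
      witness : NonTwoPeriodicEverywhere u (Z * suc (W + W) + Z)
      witness i with first-letter-recurs (suc (i / Z))
      ... | n , n≥ , n≤ , eq = Z * n + k₀ , i≤ , ≤i+N , differ
        where
        i≤ : i ≤ Z * n + k₀
        i≤ = begin
          i                          ≡⟨ m≡m%n+[m/n]*n i Z ⟩
          i % Z + (i / Z) * Z        ≤⟨ +-monoˡ-≤ _ (<⇒≤ (m%n<n i Z)) ⟩
          Z + (i / Z) * Z            ≡⟨ *-comm Z (suc (i / Z)) ⟨
          Z * suc (i / Z)            ≤⟨ *-monoʳ-≤ Z n≥ ⟩
          Z * n                      ≤⟨ m≤m+n _ k₀ ⟩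
          Z * n + k₀                 ∎
          where open ≤-Reasoning
        ≤i+N : 2 + (Z * n + k₀) ≤ i + (Z * suc (W + W) + Z)
        ≤i+N = begin
          2 + (Z * n + k₀)                           ≡⟨ trans (arith₁ (Z * n) k₀) (cong (Z * n +_) (sym K≡)) ⟩
          Z * n + K                                  ≤⟨ +-mono-≤ (*-monoʳ-≤ Z n≤) (<⇒≤ K<Z) ⟩
          Z * (suc (i / Z) + (W + W)) + Z            ≡⟨ arith₂ Z (i / Z) W ⟩
          (i / Z) * Z + (Z * suc (W + W) + Z)        ≤⟨ +-monoˡ-≤ _ (m/n*n≤m i Z) ⟩
          i + (Z * suc (W + W) + Z)                  ∎
          where
          open ≤-Reasoning
          arith₁ : ∀ a k → 2 + (a + k) ≡ a + (2 + k)
          arith₁ = solve-∀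
          arith₂ : ∀ Z d W → Z * (suc d + (W + W)) + Z ≡ d * Z + (Z * suc (W + W) + Z)
          arith₂ = solve-∀
        differ : u (Z * n + k₀) ≢ u (2 + (Z * n + k₀))
        differ eq′ = u-k₀ (begin
          u k₀                       ≡⟨ copy n eq k₀ (<-trans (subst (k₀ <_) (sym K≡) (m<n+m k₀ (s≤s z≤n))) K<Z) ⟨
          u (Z * n + k₀)             ≡⟨ eq′ ⟩
          u (2 + (Z * n + k₀))       ≡⟨ cong u (arith (Z * n) k₀) ⟩
          u (Z * n + (2 + k₀))       ≡⟨ copy n eq (2 + k₀) (subst (_< Z) K≡ K<Z) ⟩
          u (2 + k₀)                 ∎)
          where
          open ≡-Reasoning
          arith : ∀ a k → 2 + (a + k) ≡ a + (2 + k)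
          arith = solve-∀

    non-two-periodic : (∃ λ k₀ → u k₀ ≢ u (2 + k₀)) → ∃ (NonTwoPeriodicEverywhere u)
    non-two-periodic (k₀ , u-k₀) = spread-non-two-periodic (2 + k₀) k₀ refl u-k₀

-- Common prefix, common suffix and the core of a morphism.

split-common-prefix : ∀ v w → length v ≡ length w → v ≢ w →
  ∃ λ p → ∃ λ a → ∃ λ v′ → ∃ λ w′ →
  v ≡ p ++ a ∷ v′ × w ≡ p ++ not a ∷ w′ × length v′ ≡ length w′
split-common-prefix []      []      _   v≢w = contradiction refl v≢w
split-common-prefix (a ∷ v) (b ∷ w) len v≢w with a ≟ b
... | no a≢b = [] , a , v , w , refl , cong (_∷ w) (¬-not (≢-sym a≢b)) , suc-injective len
... | yes refl with split-common-prefix v w (suc-injective len) (λ eq → v≢w (cong (a ∷_) eq))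
...   | p , c , v′ , w′ , eqv , eqw , len′ = a ∷ p , c , v′ , w′ , cong (a ∷_) eqv , cong (a ∷_) eqw , len′

split-common-suffix : ∀ v w → length v ≡ length w → v ≢ w →
  ∃ λ s → ∃ λ a → ∃ λ v′ → ∃ λ w′ →
  v ≡ (v′ ∷ʳ a) ++ s × w ≡ (w′ ∷ʳ not a) ++ s × length v′ ≡ length w′
split-common-suffix v w len v≢w
  with split-common-prefix (reverse v) (reverse w)
         (trans (length-reverse v) (trans len (sym (length-reverse w))))
         (λ eq → v≢w (trans (sym (reverse-involutive v)) (trans (cong reverse eq) (reverse-involutive w))))
... | p , a , v′ , w′ , eqv , eqw , len′ =
  reverse p , a , reverse v′ , reverse w′ , back p v′ eqv , back p w′ eqw ,
  trans (length-reverse v′) (trans len′ (sym (length-reverse w′)))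
  where
  back : ∀ {x} p {a} x′ → reverse x ≡ p ++ a ∷ x′ → x ≡ (reverse x′ ∷ʳ a) ++ reverse p
  back {x} p {a} x′ eq = begin
    x                                    ≡⟨ reverse-involutive x ⟨
    reverse (reverse x)                  ≡⟨ cong reverse eq ⟩
    reverse (p ++ a ∷ x′)                ≡⟨ reverse-++ p (a ∷ x′) ⟩
    reverse (a ∷ x′) ++ reverse p        ≡⟨ cong (_++ reverse p) (unfold-reverse a x′) ⟩
    (reverse x′ ∷ʳ a) ++ reverse p       ∎
    where open ≡-Reasoning

at-last : ∀ w a → at (w ∷ʳ a) (length w) ≡ a
at-last w a = trans (cong (at (w ∷ʳ a)) (sym (+-identityʳ (length w)))) (at-++ʳ w 0)

-- Writing the distinct end letters as `p xor a` and `q xor a` lets `xor-cancelˡ` recover `a` from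
-- them.
record Core (φ : Morphism) : Set where
  field
    P S      : Word
    C        : Morphism
    m        : ℕ
    p q      : Letter
    φ≡       : ∀ a → φ a ≡ P ++ C a ++ S
    length-C : ∀ a → length (C a) ≡ suc m
    first    : ∀ a → at (C a) 0 ≡ p xor a
    last     : ∀ a → at (C a) m ≡ q xor a

-- The common suffix is taken from what remains after the common prefix, so the two cannot overlap.
-- Each middle word keeps its mismatching last letter; being nonempty, it also begins with the
-- mismatching first letter.
core : ∀ φ → IsUniform φ → φ false ≢ φ true → Core φ
core φ uniform φ≢ with split-common-prefix (φ false) (φ true) uniform φ≢
... | P , a , v , w , eqv , eqw , len
  with split-common-suffix (a ∷ v) (not a ∷ w) (cong suc len) (λ eq → not-¬ {a} refl (proj₁ (∷-injective eq)))
... | S , c , v′ , w′ , eqv′ , eqw′ , len′ = record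
  { P = P ; S = S ; C = C ; m = length v′ ; p = a ; q = c
  ; φ≡ = λ { false → trans eqv (cong (P ++_) eqv′) ; true → trans eqw (cong (P ++_) eqw′) }
  ; length-C = length-C
  ; first = λ { false → trans (head (v′ ∷ʳ c) (length-C false) eqv′) (xor-false a)
              ; true → trans (head (w′ ∷ʳ not c) (length-C true) eqw′) (xor-true a) }
  ; last = λ { false → trans (at-last v′ c) (xor-false c)
             ; true → trans (cong (at (w′ ∷ʳ not c)) len′) (trans (at-last w′ (not c)) (xor-true c)) }
  }
  where
  C : Morphism
  C false = v′ ∷ʳ c
  C true  = w′ ∷ʳ not c
  length-∷ʳ : ∀ x (b : Letter) → length (x ∷ʳ b) ≡ suc (length x)
  length-∷ʳ x b = trans (length-++ x) (+-comm (length x) 1)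
  length-C : ∀ a → length (C a) ≡ suc (length v′)
  length-C false = length-∷ʳ v′ c
  length-C true  = trans (length-∷ʳ w′ (not c)) (cong suc (sym len′))
  head : ∀ {b x n} y {s} → length y ≡ suc n → b ∷ x ≡ y ++ s → at y 0 ≡ b
  head (b ∷ y) _ eq = sym (proj₁ (∷-injective eq))
  xor-false : ∀ b → b ≡ b xor false
  xor-false b = sym (xor-identityʳ b)
  xor-true : ∀ b → not b ≡ b xor true
  xor-true false = refl
  xor-true true  = refl

-- Distinct images of the two letters.

_≟ʷ_ : (v w : Word) → Dec (v ≡ w)
_≟ʷ_ = ≡-dec _≟_

module _ (φ : Morphism) (primitive-φ : IsPrimitive φ) (uniform : IsUniform φ)
         (u : InfWord) (fixed : IsFixedPoint φ u) (aperiodic : IsAperiodic u) where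

  open FixedPoint φ u uniform fixed using (slice-block; 2≤L)

  -- Otherwise `u` would be one block of length `L` repeated forever.
  images-differ : φ false ≢ φ true
  images-differ eq = aperiodic (L , 0 , ≤-trans (s≤s z≤n) (2≤L primitive-φ) , λ n _ → periodic n)
    where
    L = length (φ false)
    instance
      L≢0 : NonZero L
      L≢0 = >-nonZero (≤-trans (s≤s z≤n) (2≤L primitive-φ))
    constant : ∀ a b → φ a ≡ φ b
    constant false false = refl
    constant false true  = eq
    constant true  false = sym eq
    constant true  true  = refl
    u-at : ∀ n j → j < L → u (L * n + j) ≡ at (φ (u n)) j
    u-at n j j<L = trans (sym (at-slice u (L * n) j j<L)) (cong (λ w → at w j) (slice-block n))
    periodic : ∀ n → u (n + L) ≡ u n
    periodic n = begin
      u (n + L)                              ≡⟨ cong (λ z → u (z + L)) n≡ ⟩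
      u (n % L + (n / L) * L + L)            ≡⟨ cong u (arith (n % L) (n / L) L) ⟩
      u (L * suc (n / L) + n % L)            ≡⟨ u-at (suc (n / L)) (n % L) (m%n<n n L) ⟩
      at (φ (u (suc (n / L)))) (n % L)       ≡⟨ cong (λ w → at w (n % L)) (constant (u (suc (n / L))) (u (n / L))) ⟩
      at (φ (u (n / L))) (n % L)             ≡⟨ u-at (n / L) (n % L) (m%n<n n L) ⟨
      u (L * (n / L) + n % L)                ≡⟨ cong u (arith′ L (n / L) (n % L)) ⟩
      u (n % L + (n / L) * L)                ≡⟨ cong u n≡ ⟨
      u n                                    ∎
      where
      open ≡-Reasoning
      n≡ = m≡m%n+[m/n]*n n L
      arith : ∀ r d L → r + d * L + L ≡ L * suc d + r
      arith = solve-∀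
      arith′ : ∀ L d r → L * d + r ≡ r + d * L
      arith′ = solve-∀

-- The conjugate `ψ`, its symmetries and the conclusion.

module _ (φ : Morphism) (primitive-φ : IsPrimitive φ) (uniform : IsUniform φ)
         (u : InfWord) (fixed : IsFixedPoint φ u) (aperiodic : IsAperiodic u)
         (infinite : InfinitelyManyAntipalFactors u) (κ : Core φ) where

  open FixedPoint φ u uniform fixed using (slice-block; length-φ; non-two-periodic)
  open Core κ

  t : Word
  t = S ++ P

  ψ : Morphism
  ψ a = C a ++ t

  o : ℕ
  o = length P

  length-φ-core : ∀ a → length (φ a) ≡ suc m + length t
  length-φ-core a = begin
    length (φ a)                                   ≡⟨ cong length (φ≡ a) ⟩
    length (P ++ C a ++ S)                         ≡⟨ length-++ P ⟩
    o + length (C a ++ S)                          ≡⟨ cong (o +_) (length-++ (C a)) ⟩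
    o + (length (C a) + length S)                  ≡⟨ cong (λ l → o + (l + length S)) (length-C a) ⟩
    o + (suc m + length S)                         ≡⟨ arith o (suc m) (length S) ⟩
    suc m + (length S + o)                         ≡⟨ cong (suc m +_) (length-++ S) ⟨
    suc m + length t                               ∎
    where
    open ≡-Reasoning
    arith : ∀ o m s → o + (m + s) ≡ m + (s + o)
    arith = solve-∀

  -- The next image also begins with `P`, so moving the block by `o` positions drops one copy of `P`
  -- on the left and gains one on the right.
  shifted-block : ∀ n → slice u ((suc m + length t) * n + o) (suc m + length t) ≡ ψ (u n)
  shifted-block n = subst (λ l → slice u (l * n + o) l ≡ ψ (u n)) (length-φ-core false) (++-cancelˡ P _ _ (begin
    P ++ slice u (L * n + o) L                     ≡⟨ cong (_++ slice u (L * n + o) L) (prefix-P n) ⟨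
    slice u (L * n) o ++ slice u (L * n + o) L     ≡⟨ slice-++ u (L * n) o L ⟨
    slice u (L * n) (o + L)                        ≡⟨ cong (slice u (L * n)) (+-comm o L) ⟩
    slice u (L * n) (L + o)                        ≡⟨ slice-++ u (L * n) L o ⟩
    slice u (L * n) L ++ slice u (L * n + L) o     ≡⟨ cong₂ (λ v i → v ++ slice u i o) (slice-block n)
                                                        (trans (+-comm (L * n) L) (sym (*-suc L n))) ⟩
    φ (u n) ++ slice u (L * suc n) o               ≡⟨ cong₂ _++_ (φ≡ (u n)) (prefix-P (suc n)) ⟩
    (P ++ C (u n) ++ S) ++ P                       ≡⟨ ++-assoc P (C (u n) ++ S) P ⟩
    P ++ (C (u n) ++ S) ++ P                       ≡⟨ cong (P ++_) (++-assoc (C (u n)) S P) ⟩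
    P ++ ψ (u n)                                   ∎))
    where
    open ≡-Reasoning
    L = length (φ false)
    prefix-P : ∀ n → slice u (L * n) o ≡ P
    prefix-P n = proj₁ (slice-split u (L * n) P
      (subst (λ w → slice u (L * n) (length w) ≡ w) (φ≡ (u n))
        (trans (cong (slice u (L * n)) (length-φ (u n))) (slice-block n))))

  ψ-conjugate : LeftConjugate ψ φ
  ψ-conjugate = P , conj
    where
    conj : ∀ w → P ++ apply ψ w ≡ apply φ w ++ P
    conj []      = ++-identityʳ P
    conj (a ∷ w) = begin
      P ++ (C a ++ S ++ P) ++ apply ψ w        ≡⟨ cong (P ++_) (trans (++-assoc (C a) (S ++ P) (apply ψ w))
                                                    (cong (C a ++_) (++-assoc S P (apply ψ w)))) ⟩
      P ++ C a ++ S ++ P ++ apply ψ w          ≡⟨ cong (λ v → P ++ C a ++ S ++ v) (conj w) ⟩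
      P ++ C a ++ S ++ apply φ w ++ P          ≡⟨ trans (++-assoc P (C a ++ S) (apply φ w ++ P))
                                                    (cong (P ++_) (++-assoc (C a) S (apply φ w ++ P))) ⟨
      (P ++ C a ++ S) ++ apply φ w ++ P        ≡⟨ cong (_++ (apply φ w ++ P)) (φ≡ a) ⟨
      φ a ++ apply φ w ++ P                    ≡⟨ ++-assoc (φ a) (apply φ w) P ⟨
      (φ a ++ apply φ w) ++ P                  ∎
      where open ≡-Reasoning

  -- The two letters are listed separately to make the condition visibly decidable, which `outcome`
  -- relies on.
  Mirrored : Letter → Letter → Set
  Mirrored β γ = (C false ≡ mirror β (C (γ xor false)) × C true ≡ mirror β (C (γ xor true))) × t ≡ mirror β t

  Outcome : Set
  Outcome = Mirrored true true ⊎ (Mirrored true false × Mirrored false true)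

  mirrored? : ∀ β γ → Dec (Mirrored β γ)
  mirrored? β γ = ((_ ≟ʷ _) ×-dec (_ ≟ʷ _)) ×-dec (_ ≟ʷ _)

  outcome? : Dec Outcome
  outcome? = mirrored? true true ⊎-dec (mirrored? true false ×-dec mirrored? false true)

  Desubstitutes : Letter → Letter → Set
  Desubstitutes β γ = ∀ r → ReflectsUnboundedly u β →
    (∃ λ lo → ∃ λ s → Reflects u γ s lo × lo + lo + r ≤ s) ×
    (∀ a → C a ≡ mirror β (C (γ xor a))) × t ≡ mirror β t

  mirrored : ∀ β γ → Desubstitutes β γ → ReflectsUnboundedly u β → Mirrored β γ
  mirrored β γ d refl-u with d 0 refl-u
  ... | _ , eqC , eqt = (eqC false , eqC true) , eqt

  -- Changing `β` flips the induced exchange. If antipalindromes induce the identity, the windows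
  -- they yield are arbitrarily long palindromes, and desubstituting these induces the exchange of
  -- letters.
  outcome-by-parity : ∀ γ γ′ → γ′ ≡ not γ → Desubstitutes true γ → Desubstitutes false γ′ → Outcome
  outcome-by-parity true  _ _    d d′ = inj₁ (mirrored true true d (antipalindromes-reflect infinite))
  outcome-by-parity false _ refl d d′ =
    inj₂ (mirrored true false d antipal , mirrored false true d′ (λ r → proj₁ (d r antipal)))
    where
    antipal = antipalindromes-reflect infinite

  outcome-if-non-periodic : ∃ (NonTwoPeriodicEverywhere u) → Outcome
  outcome-if-non-periodic (N , nonper) = outcome-by-parity (p xor (true xor q)) (p xor (false xor q)) (parity p q)
                       (desubstitutes true) (desubstitutes false)
    where
    o≤L : o ≤ suc m + length t
    o≤L = subst (o ≤_) (sym (cong (suc m +_) (length-++ S))) (m≤n⇒m≤o+n (suc m) (m≤n+m o (length S)))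
    desubstitutes : ∀ β → Desubstitutes β (p xor (β xor q))
    desubstitutes = Synchronisation.desubstitute u o m C t p q o≤L length-C first last shifted-block N nonper
    parity : ∀ a b → a xor (false xor b) ≡ not (a xor (true xor b))
    parity false false = refl
    parity false true  = refl
    parity true  false = refl
    parity true  true  = refl

  -- Aperiodicity is a negation and exhibits no violation of period 2. As `Outcome` is decidable, it
  -- suffices to refute its negation, under which no violation could exist and `u` would have period
  -- 2.
  outcome : Outcome
  outcome = decidable-stable outcome? λ ¬outcome →
    aperiodic (2 , 0 , s≤s z≤n , λ n _ → trans (cong u (+-comm n 2)) (sym
      (decidable-stable (u n ≟ u (2 + n)) λ ne → ¬outcome (outcome-if-non-periodic (non-two-periodic primitive-φ (n , ne))))))

  C≢[] : ∀ a → C a ≢ []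
  C≢[] a eq = contradiction (trans (sym (length-C a)) (cong length eq)) λ ()

  conclusion : Outcome →
    (∃ λ ψ → InA1 ψ × Conjugate φ ψ) ⊎ (∃ λ ψ → InA1 ψ × Conjugate (φ ^ₘ 2) ψ)
  conclusion (inj₁ ((_ , C-true) , t-anti)) =
    inj₁ (ψ , (C false , t , C≢[] false , sym t-anti , refl , cong (_++ t) C-true) , inj₂ ψ-conjugate)
  conclusion (inj₂ (((C-false , C-true) , t-anti) , ((C-swap , _) , t-pal))) =
    inj₂ (φ ^ₘ 2 , (φ² false , [] , φ²≢[] , refl , sym (++-identityʳ (φ² false)) , trans φ²-true (sym (++-identityʳ _)))
         , inj₁ ([] , λ w → sym (++-identityʳ _)))
    where
    φ² = φ ^ₘ 2
    -- Both symmetries together give invariance under the letterwise exchange, which fixes no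
    -- letter.
    reverse-fixed-not : ∀ w → w ≡ reverse w → w ≡ E w → w ≡ []
    reverse-fixed-not w pal anti = none w (trans anti (trans (sym (reverse-map not w)) (cong (map not) (sym pal))))
      where
      none : ∀ w → w ≡ map not w → w ≡ []
      none []          _  = refl
      none (false ∷ w) ()
      none (true ∷ w)  ()
    t≡[] : t ≡ []
    t≡[] = reverse-fixed-not t (trans t-pal (mirror-false t)) t-anti
    φ≡C : ∀ a → φ a ≡ C a
    φ≡C a = trans (φ≡ a) (trans (cong₂ (λ v w → v ++ C a ++ w) (++-conicalʳ S P t≡[]) (++-conicalˡ S P t≡[]))
      (++-identityʳ (C a)))
    E-φ : ∀ a → E (φ a) ≡ φ a
    E-φ a = trans (cong E (φ≡C a)) (trans (sym (E-C a)) (sym (φ≡C a)))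
      where
      E-C : ∀ a → C a ≡ E (C a)
      E-C false = C-false
      E-C true  = C-true
    reverse-φ-false : reverse (φ false) ≡ φ true
    reverse-φ-false = begin
      reverse (φ false)               ≡⟨ cong reverse (trans (φ≡C false) C-swap) ⟩
      reverse (mirror false (C true)) ≡⟨ cong reverse (mirror-false (C true)) ⟩
      reverse (reverse (C true))      ≡⟨ reverse-involutive (C true) ⟩
      C true                          ≡⟨ φ≡C true ⟨
      φ true                          ∎
      where open ≡-Reasoning
    apply-++ : ∀ v w → apply φ (v ++ w) ≡ apply φ v ++ apply φ w
    apply-++ = concatMap-++ φ
    E-++ : ∀ v w → E (v ++ w) ≡ E w ++ E v
    E-++ v w = trans (cong reverse (map-++ not v w)) (reverse-++ (map not v) (map not w))
    -- Every `φ a` is an antipalindrome, so `E` reverses the order of the blocks and leaves each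
    -- block as it is.
    E-apply : ∀ w → E (apply φ w) ≡ apply φ (reverse w)
    E-apply []      = refl
    E-apply (a ∷ w) = begin
      E (φ a ++ apply φ w)                           ≡⟨ E-++ (φ a) (apply φ w) ⟩
      E (apply φ w) ++ E (φ a)                       ≡⟨ cong₂ _++_ (E-apply w) (E-φ a) ⟩
      apply φ (reverse w) ++ φ a                     ≡⟨ cong (apply φ (reverse w) ++_) (++-identityʳ (φ a)) ⟨
      apply φ (reverse w) ++ apply φ (a ∷ [])        ≡⟨ apply-++ (reverse w) (a ∷ []) ⟨
      apply φ (reverse w ∷ʳ a)                       ≡⟨ cong (apply φ) (unfold-reverse a w) ⟨
      apply φ (reverse (a ∷ w))                      ∎
      where open ≡-Reasoning
    φ²≡ : ∀ a → φ² a ≡ apply φ (φ a)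
    φ²≡ a = cong (apply φ) (++-identityʳ (φ a))
    φ²-true : φ² true ≡ E (φ² false)
    φ²-true = begin
      φ² true                         ≡⟨ φ²≡ true ⟩
      apply φ (φ true)                ≡⟨ cong (apply φ) reverse-φ-false ⟨
      apply φ (reverse (φ false))     ≡⟨ E-apply (φ false) ⟨
      E (apply φ (φ false))           ≡⟨ cong E (φ²≡ false) ⟨
      E (φ² false)                    ∎
      where open ≡-Reasoning
    φ≢[] : ∀ a → φ a ≢ []
    φ≢[] a eq = C≢[] a (trans (sym (φ≡C a)) eq)
    φ²≢[] : φ² false ≢ []
    φ²≢[] eq = nonempty (φ false) (φ≢[] false) (trans (sym (φ²≡ false)) eq)
      where
      nonempty : ∀ w → w ≢ [] → apply φ w ≢ []
      nonempty []      w≢ _  = w≢ refl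
      nonempty (a ∷ w) _  eq = φ≢[] a (++-conicalˡ (φ a) (apply φ w) eq)

theorem34 : (φ : Morphism) → IsPrimitive φ → IsUniform φ →
    (u : InfWord) → IsFixedPoint φ u → IsAperiodic u →
    InfinitelyManyAntipalFactors u →
    (∃ λ ψ → InA1 ψ × Conjugate φ ψ) ⊎ (∃ λ ψ → InA1 ψ × Conjugate (φ ^ₘ 2) ψ)
theorem34 φ primitive-φ uniform u fixed aperiodic infinite =
  conclusion φ primitive-φ uniform u fixed aperiodic infinite κ
    (outcome φ primitive-φ uniform u fixed aperiodic infinite κ)
  where
  κ = core φ uniform (images-differ φ primitive-φ uniform u fixed aperiodic)
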